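{- Let $N = 2^M$ with $M \ge 1$ an integer, let $k$ be an integer with $2 \le k < N$, and let $g_1,\dots,g_N \ge 0$ and $h_1,\dots,h_N > 0$ be reals with $\sum_{i=1}^N g_i = \sum_{i=1}^N h_i = 1$. Let $\mathrm{DP}_{\mathrm{true}}$ be the table computed by the exact dynamic programming recursion, let $\mathrm{DP}_{\mathrm{mm}}$ be the table computed with the monotone maxima algorithm, and let $\delta_{\max}$ be the quantity determined by $(g_i),(h_i)$ and $N$, all as defined in the context. Then for all $p = 1,2,\dots,N-1$ and $q = 1,2,\dots,k-1$, $$0 \le \mathrm{DP}_{\mathrm{true}}[p][q] - \mathrm{DP}_{\mathrm{mm}}[p][q] \le q\,\delta_{\max},$$ where, as the tables take values in $\mathbb{R}\cup\{ -\infty\}$, this is understood as $\mathrm{DP}_{\mathrm{mm}}[p][q] \le \mathrm{DP}_{\mathrm{true}}[p][q] \le \mathrm{DP}_{\mathrm{mm}}[p][q] + q\,\delta_{\max}$.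
   Context: For integers $1 \le i_l \le i_r \le N$, $$d_{\mathrm{KL}}(i_l,i_r) = \left(\sum_{i=i_l}^{i_r} g_i\right) \log_2\left(\frac{\sum_{i=i_l}^{i_r} g_i}{\sum_{i=i_l}^{i_r} h_i}\right),$$ with the convention $0\log_2 0 = 0$. Throughout, $-\infty + x = -\infty$ for real $x$. Both tables $\mathrm{DP}[p][q]$ ($p = 0,\dots,N-1$, $q = 0,\dots,k-1$) satisfy $\mathrm{DP}[0][0] = 0$ and $\mathrm{DP}[p][q] = -\infty$ if exactly one of $p,q$ is $0$. Exact table: for $p,q \ge 1$, $\mathrm{DP}_{\mathrm{true}}[p][q] = \max_{i=1,\dots,p}\bigl(\mathrm{DP}_{\mathrm{true}}[i-1][q-1] + d_{\mathrm{KL}}(i,p)\bigr)$. Table with monotone maxima: for each $q = 1,\dots,k-1$ in turn, form the $(N-1)\times(N-1)$ matrix $A$ with $$A_{p,i} = \begin{cases}\mathrm{DP}_{\mathrm{mm}}[i-1][q-1] + d_{\mathrm{KL}}(i,p) & (1 \le i \le p)\\ -\infty & (i > p),\end{cases}$$ run the monotone maxima algorithm on $A$ to obtain column indices $\hat J(1),\dots,\hat J(N-1)$, and set $\mathrm{DP}_{\mathrm{mm}}[p][q] = A_{p,\hat J(p)}$ for $p=1,\dots,N-1$. Monotone maxima algorithm: called on a block of consecutive rows $a,\dots,b$ and a column range $[L,R]$ (initially rows $1,\dots,N-1$ and columns $[1,N-1]$). If the block is empty, stop. Otherwise take the middle row $m = (a+b)/2$ (always an integer as $N=2^M$), let $\hat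 J(m)$ be the smallest $j \in [L,R]$ maximizing $A_{m,j}$ over $j \in [L,R]$, and recurse on rows $a,\dots,m-1$ with columns $[L,\hat J(m)]$ and on rows $m+1,\dots,b$ with columns $[\hat J(m),R]$. Definition of $\delta_{\max}$: define $\Delta : \{0,1,\dots,N\}^2 \to \mathbb{R}$ by $$\Delta(p,p') = \max_{1 \le i \le i' \le p}\Bigl[-\bigl(d_{\mathrm{KL}}(i,p) + d_{\mathrm{KL}}(i',p')\bigr) + \bigl(d_{\mathrm{KL}}(i,p') + d_{\mathrm{KL}}(i',p)\bigr)\Bigr] \quad (0 < p < p' < N),$$ and $\Delta(p,p') = 0$ otherwise. Define $\delta : \{0,1,\dots,N\}\to\mathbb{R}$ recursively by $\delta(0) = \delta(N) = 0$ and, for $0 < p < N$, $$\delta(p) = \max\bigl(\delta(l) + \Delta(l,p),\ 0,\ \delta(r) + \Delta(p,r)\bigr),$$ where $l = p - 2^m$, $r = p + 2^m$, and $m$ is the largest nonnegative integer such that $2^m$ divides $p$ (so $l$ and $r$ are the nearest rows below and above $p$ in index that are processed before row $p$ by the monotone maxima algorithm, with $l=0$ or $r=N$ if there is none). Finally, $\delta_{\max} = \max_{p=1,\dots,N-1} \delta(p)$. -}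

module Defs where

open import Level using (Level) renaming (suc to lsuc)
open import Algebra.Bundles using (CommutativeRing; Semiring)
import Algebra.Definitions.RawMonoid as RawMonoidDefs
import Algebra.Definitions.RawSemiring as RawSemiringDefs
open import Data.Bool.Base using (if_then_else_; _∧_)
open import Data.List.Base using (List; []; _∷_; map; foldr; filter; upTo; applyUpTo; concatMap)
import Data.List.Extrema as Extrema
import Data.List.Extrema.Nat as ℕ-Extrema
open import Data.Nat.Base as ℕ using (ℕ; zero; suc; _∸_)
open import Data.Nat.Divisibility using (_∣?_)
open import Data.Nat.DivMod using (_/_)
import Data.Nat.Properties as ℕ
open import Data.Product.Base using (_×_; ∃; ∃-syntax)
open import Relation.Binary.Bundles using (DecTotalOrder)
open import Relation.Binary.Core using (Rel)
open import Relation.Binary.Definitions using (tri<; tri≈; tri>)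
open import Relation.Binary.Structures using (IsDecTotalOrder)
import Relation.Binary.Construct.Add.Infimum.Equality as InfimumEquality
import Relation.Binary.Construct.Add.Infimum.NonStrict as InfimumOrder
import Relation.Binary.Construct.NonStrictToStrict as ToStrict
open import Relation.Nullary.Construct.Add.Infimum using (_₋; ⊥₋; [_])
open import Relation.Nullary.Decidable.Core using (does)
open import Relation.Nullary.Negation.Core using (¬_)

-- The real numbers, as in classical analysis: a Dedekind-complete ordered
-- field with decidable order.  Classically such a field is unique up to
-- unique isomorphism.  Operations are total; `_⁻¹` is unconstrained at 0 and
-- `sup` is unconstrained on sets that are empty or unbounded above.
record Reals (ℓ : Level) : Set (lsuc ℓ) where
  infix  8 _⁻¹
  infix  4 _≤ᴿ_ _<ᴿ_
  infixr 8 _·_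

  field
    commutativeRing : CommutativeRing ℓ ℓ
  open CommutativeRing commutativeRing public

  field
    _≤ᴿ_            : Rel Carrier ℓ
    isDecTotalOrder : IsDecTotalOrder _≈_ _≤ᴿ_
    0≉1             : ¬ (0# ≈ 1#)
    +-monoʳ-≤       : ∀ x {y z} → y ≤ᴿ z → x + y ≤ᴿ x + z
    *-nonneg        : ∀ {x y} → 0# ≤ᴿ x → 0# ≤ᴿ y → 0# ≤ᴿ x * y
    _⁻¹             : Carrier → Carrier
    ⁻¹-inverseʳ     : ∀ {x} → ¬ (x ≈ 0#) → x * x ⁻¹ ≈ 1#

  UpperBound : (Carrier → Set ℓ) → Carrier → Set ℓ
  UpperBound P u = ∀ x → P x → x ≤ᴿ u

  field
    sup       : (Carrier → Set ℓ) → Carrier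
    sup-upper : ∀ P → ∃ P → ∃ (UpperBound P) → UpperBound P (sup P)
    sup-least : ∀ P → ∃ P → ∀ u → UpperBound P u → sup P ≤ᴿ u

  open IsDecTotalOrder isDecTotalOrder public
    using (_≟_; _≤?_)
    renaming (refl to ≤ᴿ-refl; trans to ≤ᴿ-trans; antisym to ≤ᴿ-antisym; total to ≤ᴿ-total)

  decTotalOrder : DecTotalOrder ℓ ℓ ℓ
  decTotalOrder = record { isDecTotalOrder = isDecTotalOrder }

  _<ᴿ_ : Rel Carrier ℓ
  _<ᴿ_ = ToStrict._<_ _≈_ _≤ᴿ_

  _·_ : ℕ → Carrier → Carrier
  _·_ = RawMonoidDefs._×_ +-rawMonoid

  open RawSemiringDefs (Semiring.rawSemiring semiring) public using (_^_)
  open Extrema (DecTotalOrder.totalOrder decTotalOrder) public using (max)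

  -- log₂ x = sup { r ∈ ℚ : 2 ^ r ≤ x } for x > 0 (a junk value otherwise).
  -- The rational r = (a - b) / (1 + c) satisfies 2 ^ r ≤ x exactly when
  -- 2 ^ a ≤ 2 ^ b * x ^ (1 + c).
  log₂ : Carrier → Carrier
  log₂ x = sup λ r → ∃[ a ] ∃[ b ] ∃[ c ]
    (suc c · r + b · 1# ≈ a · 1#) × (2# ^ a ≤ᴿ 2# ^ b * x ^ suc c)
    where 2# = 1# + 1#

  -- ℝ ∪ {-∞}, with -∞ = ⊥₋.
  ℝ₋∞ : Set ℓ
  ℝ₋∞ = Carrier ₋

  open InfimumOrder _≤ᴿ_ public using (_≤₋_; ⊥₋≤_; [_])

  decTotalOrder₋ : DecTotalOrder ℓ ℓ ℓ
  decTotalOrder₋ = record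
    { isDecTotalOrder = InfimumOrder.≤₋-isDecTotalOrder _≤ᴿ_ isDecTotalOrder }

  open Extrema (DecTotalOrder.totalOrder decTotalOrder₋) public
    using () renaming (max to max₋)

  infixl 6 _+₋_
  _+₋_ : ℝ₋∞ → Carrier → ℝ₋∞
  ⊥₋    +₋ y = ⊥₋
  [ x ] +₋ y = [ x + y ]

-- The integers a, …, b.
[_⋯_] : ℕ → ℕ → List ℕ
[ a ⋯ b ] = applyUpTo (a ℕ.+_) (suc b ∸ a)

module MonotoneMaxima {c ℓ₁ ℓ₂} (O : DecTotalOrder c ℓ₁ ℓ₂)
                      (A : ℕ → ℕ → DecTotalOrder.Carrier O) where
  open DecTotalOrder O using (_≤?_)

  -- The smallest maximizer of f over {L, …, L + n}.
  leftmostArgmax : (ℕ → DecTotalOrder.Carrier O) → ℕ → ℕ → ℕ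
  leftmostArgmax f L zero    = L
  leftmostArgmax f L (suc n) =
    let j = leftmostArgmax f L n
        j′ = L ℕ.+ suc n
    in if does (f j′ ≤? f j) then j else j′

  -- `search fuel a b L R p` is the index found for row p by the call on rows
  -- a, …, b and columns [L, R].  It is 0 if p is not one of these rows.  The
  -- number of rows drops at each call, so any fuel ≥ that number suffices.
  search : ℕ → ℕ → ℕ → ℕ → ℕ → ℕ → ℕ
  search zero       a b L R p = 0
  search (suc fuel) a b L R p = if does (a ℕ.≤? b) then split else 0
    where
    m = (a ℕ.+ b) / 2
    J = leftmostArgmax (A m) L (R ∸ L)

    split : ℕ
    split with ℕ.<-cmp p m
    ... | tri< _ _ _ = search fuel a (m ∸ 1) L J p
    ... | tri≈ _ _ _ = J
    ... | tri> _ _ _ = search fuel (suc m) b J R p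

  -- The run on rows 1, …, n and columns [1, n].
  Ĵ : ℕ → ℕ → ℕ
  Ĵ n = search n 1 n 1 n

-- The largest m such that 2 ^ m divides p, for p > 0.
ν₂ : ℕ → ℕ
ν₂ p = ℕ-Extrema.max 0 (filter (λ m → 2 ℕ.^ m ∣? p) (upTo p))

-- g and h are used at the indices 1, …, N only.
module Tables {ℓ} (ℝ : Reals ℓ) (N : ℕ) (g h : ℕ → Reals.Carrier ℝ) where
  open Reals ℝ

  ∑ : (ℕ → Carrier) → ℕ → ℕ → Carrier
  ∑ f a b = foldr _+_ 0# (map f [ a ⋯ b ])

  dKL : ℕ → ℕ → Carrier
  dKL l r = if does (G ≟ 0#) then 0# else G * log₂ (G * H ⁻¹)
    where
    G = ∑ g l r
    H = ∑ h l r

  DPtrue : ℕ → ℕ → ℝ₋∞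
  DPtrue zero    zero    = [ 0# ]
  DPtrue zero    (suc q) = ⊥₋
  DPtrue (suc p) zero    = ⊥₋
  DPtrue (suc p) (suc q) =
    max₋ ⊥₋ (map (λ i → DPtrue (i ∸ 1) q +₋ dKL i (suc p)) [ 1 ⋯ suc p ])

  -- The matrix A built from the previous column of the table.
  matrix : (ℕ → ℝ₋∞) → ℕ → ℕ → ℝ₋∞
  matrix prev p i = if does (i ℕ.≤? p) then prev (i ∸ 1) +₋ dKL i p else ⊥₋

  DPmm : ℕ → ℕ → ℝ₋∞
  DPmm zero    zero    = [ 0# ]
  DPmm zero    (suc q) = ⊥₋
  DPmm (suc p) zero    = ⊥₋
  DPmm (suc p) (suc q) = A (suc p) (Ĵ (N ∸ 1) (suc p))
    where
    A = matrix (λ i → DPmm i q)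
    open MonotoneMaxima decTotalOrder₋ A

  Δ : ℕ → ℕ → Carrier
  Δ p p′ =
    if does (0 ℕ.<? p) ∧ does (p ℕ.<? p′) ∧ does (p′ ℕ.<? N)
    then max (gap 1 1) (concatMap (λ i′ → map (λ i → gap i i′) [ 1 ⋯ i′ ]) [ 1 ⋯ p ])
    else 0#
    where
    gap : ℕ → ℕ → Carrier
    gap i i′ = - (dKL i p + dKL i′ p′) + (dKL i p′ + dKL i′ p)

  -- At each recursive call ν₂ increases until 0 or N is reached, so fuel N
  -- suffices when N is a power of 2.
  δ-fuel : ℕ → ℕ → Carrier
  δ-fuel zero       p = 0#
  δ-fuel (suc fuel) p =
    if does (0 ℕ.<? p) ∧ does (p ℕ.<? N)
    then max 0# (δ-fuel fuel l + Δ l p ∷ δ-fuel fuel r + Δ p r ∷ [])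
    else 0#
    where
    l = p ∸ 2 ℕ.^ ν₂ p
    r = p ℕ.+ 2 ℕ.^ ν₂ p

  δ : ℕ → Carrier
  δ = δ-fuel N

  δmax : Carrier
  δmax = max (δ 1) (map δ [ 1 ⋯ N ∸ 1 ])

-- Let a column j of row p lie outside the searched range, say j < Ĵ(l) for the
-- nearest processed row l below p.  Inductively A(l, j) ≤ A(l, Ĵ(l)) + δ(l).  Both
-- entries contain the row-independent terms DP[j - 1] and DP[Ĵ(l) - 1], so passing
-- from row l to row p changes the inequality only by a combination of four costs,
-- which is at most Δ(l, p).  Hence A(p, j) ≤ A(p, Ĵ(l)) + δ(l) + Δ(l, p), which is
-- at most A(p, Ĵ(p)) + δ(p).  The case j > Ĵ(r) is symmetric.  So each column of
-- the table adds an error of at most δmax.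

module Submission where

open import Defs
open import Data.Bool.Base using (true; false; if_then_else_)
open import Data.List.Base using (List; _∷_; []; map; concatMap; filter; upTo)
import Data.List.Extrema as Extrema
import Data.List.Extrema.Nat as ℕ-Extrema
open import Data.List.Membership.Propositional using (_∈_; lose)
open import Data.List.Membership.Propositional.Properties
  using (∈-applyUpTo⁺; ∈-applyUpTo⁻; ∈-map⁺; ∈-concatMap⁺; ∈-filter⁺; ∈-filter⁻; ∈-upTo⁺)
open import Data.List.Relation.Unary.All as All using (All; _∷_; [])
import Data.List.Relation.Unary.All.Properties as All
open import Data.List.Relation.Unary.Any using (here; there)
open import Data.Nat.Base as ℕ using (ℕ; zero; suc; _≤_; _<_; _^_; _∸_; z≤n; s≤s)
open import Data.Nat.Divisibility using (_∣_; _∣?_; _∣0; ∣-trans; ∣-refl; ∣⇒≤;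
  ∣m∣n⇒∣m+n; ∣m+n∣m⇒∣n; n∣m*n; m∣m*n)
open import Data.Nat.DivMod using (_/_; m*n/n≡m)
import Data.Nat.Properties as ℕ
open import Data.Nat.Tactic.RingSolver using (solve-∀)
open import Data.Product.Base using (_×_; _,_; proj₂)
open import Data.Sum.Base as Sum using (_⊎_; inj₁; inj₂)
open import Relation.Binary.Bundles using (DecTotalOrder)
open import Relation.Binary.Definitions using (tri<; tri≈; tri>)
open import Relation.Binary.PropositionalEquality.Core as ≡ using (_≡_; refl; cong; subst)
import Relation.Binary.Properties.TotalOrder as TotalOrderProperties
import Relation.Binary.Reasoning.PartialOrder as ≤-Reasoning
open import Relation.Nullary.Construct.Add.Infimum using (⊥₋; [_])
open import Relation.Nullary.Decidable using (Dec; does; _×-dec_; yes; no; dec-true; dec-false)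
open import Relation.Nullary.Negation using (¬_; contradiction)
import Algebra.Solver.CommutativeMonoid as CommutativeMonoidSolver

-- Integer intervals and the 2-adic valuation.

∈-[⋯]⁺ : ∀ {a b i} → a ≤ i → i ≤ b → i ∈ [ a ⋯ b ]
∈-[⋯]⁺ {a} {b} a≤i i≤b with d , refl ← ℕ.m≤n⇒∃[o]m+o≡n a≤i =
  ∈-applyUpTo⁺ (a ℕ.+_) (ℕ.m+n≤o⇒m≤o∸n (suc d) (s≤s (subst (_≤ b) (ℕ.+-comm a d) i≤b)))

∈-[1⋯]⁻ : ∀ {b i} → i ∈ [ 1 ⋯ b ] → 1 ≤ i × i ≤ b
∈-[1⋯]⁻ i∈ with d , d<b , refl ← ∈-applyUpTo⁻ suc i∈ = s≤s z≤n , d<b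

n<2^n : ∀ n → n < 2 ^ n
n<2^n zero    = s≤s z≤n
n<2^n (suc n) = ℕ.+-mono-≤ (ℕ.m^n>0 2 n) (ℕ.≤-trans (n<2^n n) (ℕ.m≤m+n _ 0))

2^[1+n]≡2^n+2^n : ∀ n → 2 ^ suc n ≡ 2 ^ n ℕ.+ 2 ^ n
2^[1+n]≡2^n+2^n n = cong (2 ^ n ℕ.+_) (ℕ.+-identityʳ (2 ^ n))

-- Identifies the neighbours that `δ-fuel` finds through `ν₂` with the rows bounding a block of
-- `search`. If `2 ^ t` with `t > s` divided the sum, `2 ^ suc s` would divide `2 ^ s`.
ν₂-odd-multiple : ∀ {s l} → 2 ^ suc s ∣ l → ν₂ (l ℕ.+ 2 ^ s) ≡ s
ν₂-odd-multiple {s} {l} 2^1+s∣l = ℕ.≤-antisym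
  (ℕ-Extrema.max≤v⁺ z≤n (All.tabulate λ t∈ → maximal (proj₂ (∈-filter⁻ P? {xs = upTo m} t∈))))
  (All.lookup (ℕ-Extrema.xs≤max 0 (filter P? (upTo m))) (∈-filter⁺ P? (∈-upTo⁺ s<m) 2^s∣m))
  where
  m = l ℕ.+ 2 ^ s
  P? = λ t → 2 ^ t ∣? m

  -- `ν₂ m` tests only exponents below `m`, so `s` has to be among them.
  s<m : s < m
  s<m = ℕ.<-≤-trans (n<2^n s) (ℕ.m≤n+m (2 ^ s) l)

  2^s∣m : 2 ^ s ∣ m
  2^s∣m = ∣m∣n⇒∣m+n (∣-trans (n∣m*n 2) 2^1+s∣l) ∣-refl

  maximal : ∀ {t} → 2 ^ t ∣ m → t ≤ s
  maximal {t} 2^t∣m = ℕ.≮⇒≥ s≮t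
    where
    s≮t : ¬ (s < t)
    s≮t s<t with d , refl ← ℕ.m≤n⇒∃[o]m+o≡n s<t =
      ℕ.<⇒≱ (ℕ.^-monoʳ-< 2 (s≤s (s≤s z≤n)) (ℕ.n<1+n s))
        (∣⇒≤ {{ℕ.m^n≢0 2 s}} (∣m+n∣m⇒∣n (∣-trans 2^1+s∣2^t 2^t∣m) 2^1+s∣l))
      where
      2^1+s∣2^t : 2 ^ suc s ∣ 2 ^ (suc s ℕ.+ d)
      2^1+s∣2^t = subst (2 ^ suc s ∣_) (≡.sym (ℕ.^-distribˡ-+-* 2 (suc s) d)) (m∣m*n (2 ^ d))

if-dec-true : ∀ {a p} {A : Set a} {P : Set p} (P? : Dec P) → P → {x y : A} →
              (if does P? then x else y) ≡ x
if-dec-true P? p {x} {y} = cong (λ b → if b then x else y) (dec-true P? p)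

if-dec-false : ∀ {a p} {A : Set a} {P : Set p} (P? : Dec P) → ¬ P → {x y : A} →
               (if does P? then x else y) ≡ y
if-dec-false P? ¬p {x} {y} = cong (λ b → if b then x else y) (dec-false P? ¬p)

if-both : ∀ {a q} {A : Set a} (Q : A → Set q) b {x y : A} → Q x → Q y → Q (if b then x else y)
if-both Q true  qx qy = qx
if-both Q false qx qy = qy

-- Inequalities in the reals with `-∞` adjoined.

module ExtendedReals {ℓ} (ℝ : Reals ℓ) where
  open Reals ℝ hiding (_^_) renaming (refl to ≈-refl)
  open DecTotalOrder decTotalOrder using (poset) renaming (reflexive to ≤ᴿ-reflexive)
  open DecTotalOrder decTotalOrder₋ public using () renaming (refl to ≤₋-refl; trans to ≤₋-trans)
  open CommutativeMonoidSolver +-commutativeMonoid using (solve; _⊜_; _⊕_)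
  open ≤-Reasoning poset

  +-mono-≤ : ∀ {x y u v} → x ≤ᴿ y → u ≤ᴿ v → x + u ≤ᴿ y + v
  +-mono-≤ {x} {y} {u} {v} x≤y u≤v = begin
    x + u  ≤⟨ +-monoʳ-≤ x u≤v ⟩
    x + v  ≈⟨ +-comm x v ⟩
    v + x  ≤⟨ +-monoʳ-≤ v x≤y ⟩
    v + y  ≈⟨ +-comm v y ⟩
    y + v  ∎

  -x+[x+y]≈y : ∀ x y → - x + (x + y) ≈ y
  -x+[x+y]≈y x y = trans (sym (+-assoc (- x) x y)) (trans (+-congʳ (-‿inverseˡ x)) (+-identityˡ y))

  +-cancelˡ-≤ : ∀ x {y z} → x + y ≤ᴿ x + z → y ≤ᴿ z
  +-cancelˡ-≤ x {y} {z} x+y≤x+z = begin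
    y              ≈⟨ -x+[x+y]≈y x y ⟨
    - x + (x + y)  ≤⟨ +-monoʳ-≤ (- x) x+y≤x+z ⟩
    - x + (x + z)  ≈⟨ -x+[x+y]≈y x z ⟩
    z              ∎

  -- Here `x` and `y` are the row-independent parts of two entries, `a` and `b` their costs in the
  -- old row, `c` and `d` those in the new one. Adding the two hypotheses and cancelling `a + b`
  -- leaves the claim.
  exchange : ∀ {x y a b c d e D} → x + a ≤ᴿ (y + b) + e → - (a + d) + (c + b) ≤ᴿ D →
             x + c ≤ᴿ (y + d) + (e + D)
  exchange {x} {y} {a} {b} {c} {d} {e} {D} x+a≤y+b+e gap≤D = +-cancelˡ-≤ (a + b) (begin
    (a + b) + (x + c)                 ≈⟨ solve 4 (λ x a b c →
      (a ⊕ b) ⊕ (x ⊕ c) ⊜ (x ⊕ a) ⊕ (c ⊕ b)) ≈-refl x a b c ⟩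
    (x + a) + (c + b)                 ≤⟨ +-mono-≤ x+a≤y+b+e c+b≤a+d+D ⟩
    ((y + b) + e) + ((a + d) + D)     ≈⟨ solve 6 (λ y a b d e D →
      ((y ⊕ b) ⊕ e) ⊕ ((a ⊕ d) ⊕ D) ⊜ (a ⊕ b) ⊕ ((y ⊕ d) ⊕ (e ⊕ D))) ≈-refl y a b d e D ⟩
    (a + b) + ((y + d) + (e + D))     ∎)
    where
    c+b≤a+d+D : c + b ≤ᴿ (a + d) + D
    c+b≤a+d+D = +-cancelˡ-≤ (- (a + d)) (begin
      - (a + d) + (c + b)        ≤⟨ gap≤D ⟩
      D                          ≈⟨ -x+[x+y]≈y (a + d) D ⟨
      - (a + d) + ((a + d) + D)  ∎)

  gap-comm : ∀ a b c d {D} → - (a + b) + (c + d) ≤ᴿ D → - (b + a) + (d + c) ≤ᴿ D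
  gap-comm a b c d gap≤D = ≤ᴿ-trans
    (≤ᴿ-reflexive (+-cong (-‿cong (+-comm b a)) (+-comm d c))) gap≤D

  -- For `X` finite the hypothesis rules out `Y = -∞`, which leaves the real case.
  exchange₋ : ∀ X Y {a b c d e D} → X +₋ a ≤₋ Y +₋ b +₋ e → - (a + d) + (c + b) ≤ᴿ D →
              X +₋ c ≤₋ Y +₋ d +₋ (e + D)
  exchange₋ ⊥₋    Y     _           _     = ⊥₋≤ _
  exchange₋ [ x ] [ y ] [ x+a≤y+b+e ] gap≤D = [ exchange x+a≤y+b+e gap≤D ]

  +₋-monoˡ : ∀ a {X Y} → X ≤₋ Y → X +₋ a ≤₋ Y +₋ a
  +₋-monoˡ a (⊥₋≤ _)  = ⊥₋≤ _
  +₋-monoˡ a [ x≤y ] = [ +-mono-≤ x≤y ≤ᴿ-refl ]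

  +₋-monoʳ : ∀ X {a b} → a ≤ᴿ b → X +₋ a ≤₋ X +₋ b
  +₋-monoʳ ⊥₋    a≤b = ⊥₋≤ _
  +₋-monoʳ [ x ] a≤b = [ +-monoʳ-≤ x a≤b ]

  +₋-assoc-≤ : ∀ X a b → X +₋ a +₋ b ≤₋ X +₋ (a + b)
  +₋-assoc-≤ ⊥₋    a b = ⊥₋≤ _
  +₋-assoc-≤ [ x ] a b = [ ≤ᴿ-reflexive (+-assoc x a b) ]

  +₋-swap-≤ : ∀ X a b → X +₋ a +₋ b ≤₋ X +₋ b +₋ a
  +₋-swap-≤ ⊥₋    a b = ⊥₋≤ _
  +₋-swap-≤ [ x ] a b = [ ≤ᴿ-reflexive (solve 3 (λ x a b → (x ⊕ a) ⊕ b ⊜ (x ⊕ b) ⊕ a) ≈-refl x a b) ]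

  ≤₋-+₋-nonneg : ∀ X {a} → 0# ≤ᴿ a → X ≤₋ X +₋ a
  ≤₋-+₋-nonneg ⊥₋    0≤a = ⊥₋≤ _
  ≤₋-+₋-nonneg [ x ] {a} 0≤a = [ (begin
    x       ≈⟨ +-identityʳ x ⟨
    x + 0#  ≤⟨ +-monoʳ-≤ x 0≤a ⟩
    x + a   ∎) ]

-- Leftmost maximizers and the branches of `search`.

module LeftmostArgmax {c ℓ₁ ℓ₂} (O : DecTotalOrder c ℓ₁ ℓ₂)
                      (A : ℕ → ℕ → DecTotalOrder.Carrier O) where
  open DecTotalOrder O using () renaming
    (Carrier to C; _≤_ to _⊑_; _≤?_ to _⊑?_; refl to ⊑-refl; trans to ⊑-trans)
  open TotalOrderProperties (DecTotalOrder.totalOrder O) using (≰⇒≥)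
  open MonotoneMaxima O A

  leftmostArgmax-≥ : ∀ (f : ℕ → C) L n → L ≤ leftmostArgmax f L n
  leftmostArgmax-≥ f L zero = ℕ.≤-refl
  leftmostArgmax-≥ f L (suc n)
    with does (f (L ℕ.+ suc n) ⊑? f (leftmostArgmax f L n))
  ... | true  = leftmostArgmax-≥ f L n
  ... | false = ℕ.m≤m+n L (suc n)

  leftmostArgmax-≤ : ∀ (f : ℕ → C) L n → leftmostArgmax f L n ≤ L ℕ.+ n
  leftmostArgmax-≤ f L zero = ℕ.m≤m+n L 0
  leftmostArgmax-≤ f L (suc n)
    with does (f (L ℕ.+ suc n) ⊑? f (leftmostArgmax f L n))
  ... | true  = ℕ.≤-trans (leftmostArgmax-≤ f L n) (ℕ.+-monoʳ-≤ L (ℕ.n≤1+n n))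
  ... | false = ℕ.≤-refl

  leftmostArgmax-max : ∀ (f : ℕ → C) L n {j} → L ≤ j → j ≤ L ℕ.+ n → f j ⊑ f (leftmostArgmax f L n)
  leftmostArgmax-max f L zero {j} L≤j j≤L+0
    with refl ← ℕ.≤-antisym L≤j (subst (j ≤_) (ℕ.+-identityʳ L) j≤L+0) = ⊑-refl
  leftmostArgmax-max f L (suc n) {j} L≤j j≤L+1+n
    with f (L ℕ.+ suc n) ⊑? f (leftmostArgmax f L n) | ℕ.m≤n⇒m<n∨m≡n j≤L+1+n
  ... | yes f≤ | inj₂ refl    = f≤
  ... | no  _  | inj₂ refl    = ⊑-refl
  ... | yes _  | inj₁ j<L+1+n =
    leftmostArgmax-max f L n L≤j (ℕ.≤-pred (subst (j <_) (ℕ.+-suc L n) j<L+1+n))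
  ... | no f≰  | inj₁ j<L+1+n =
    ⊑-trans (leftmostArgmax-max f L n L≤j (ℕ.≤-pred (subst (j <_) (ℕ.+-suc L n) j<L+1+n))) (≰⇒≥ f≰)

  -- A later column replaces the current one only if its value is strictly larger, so a final value
  -- not above that of `L` means that no replacement took place.
  leftmostArgmax-leftmost : ∀ (f : ℕ → C) L n → f (leftmostArgmax f L n) ⊑ f L → leftmostArgmax f L n ≡ L
  leftmostArgmax-leftmost f L zero    _ = refl
  leftmostArgmax-leftmost f L (suc n) f≤fL
    with f (L ℕ.+ suc n) ⊑? f (leftmostArgmax f L n)
  ... | yes _  = leftmostArgmax-leftmost f L n f≤fL
  ... | no  f≰ = contradiction
    (⊑-trans f≤fL (leftmostArgmax-max f L n ℕ.≤-refl (ℕ.m≤m+n L n))) f≰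

  module _ {fuel a b L R p : ℕ} (a≤b : a ≤ b) where
    private
      m = (a ℕ.+ b) / 2
      J = leftmostArgmax (A m) L (R ∸ L)

    search-< : p < m → search (suc fuel) a b L R p ≡ search fuel a (m ∸ 1) L J p
    search-< p<m rewrite dec-true (a ℕ.≤? b) a≤b with ℕ.<-cmp p m
    ... | tri< _ _ _   = refl
    ... | tri≈ p≮m _ _ = contradiction p<m p≮m
    ... | tri> p≮m _ _ = contradiction p<m p≮m

    search-≡ : p ≡ m → search (suc fuel) a b L R p ≡ J
    search-≡ p≡m rewrite dec-true (a ℕ.≤? b) a≤b with ℕ.<-cmp p m
    ... | tri< _ p≢m _ = contradiction p≡m p≢m
    ... | tri≈ _ _ _   = refl
    ... | tri> _ p≢m _ = contradiction p≡m p≢m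

    search-> : m < p → search (suc fuel) a b L R p ≡ search fuel (suc m) b J R p
    search-> m<p rewrite dec-true (a ℕ.≤? b) a≤b with ℕ.<-cmp p m
    ... | tri< _ _ m≮p = contradiction m<p m≮p
    ... | tri≈ _ _ m≮p = contradiction m<p m≮p
    ... | tri> _ _ _   = refl

module Accuracy {ℓ} (ℝ : Reals ℓ) (M : ℕ) (g h : ℕ → Reals.Carrier ℝ) where
  open Reals ℝ hiding (_^_) renaming (refl to ≈-refl)
  open ExtendedReals ℝ

  private
    N = 2 ^ M
    module Max = Extrema (DecTotalOrder.totalOrder decTotalOrder)
    module Max₋ = Extrema (DecTotalOrder.totalOrder decTotalOrder₋)

  open Tables ℝ N g h

  -- Lower bounds for `Δ` and `δ-fuel`.

  gap≤Δ : ∀ {p p′ i i′} → 0 < p → p < p′ → p′ < N → 1 ≤ i → i ≤ i′ → i′ ≤ p →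
          - (dKL i p + dKL i′ p′) + (dKL i p′ + dKL i′ p) ≤ᴿ Δ p p′
  gap≤Δ {p} {p′} {i} {i′} 0<p p<p′ p′<N 1≤i i≤i′ i′≤p = subst (gap i i′ ≤ᴿ_)
    (≡.sym (if-dec-true ((0 ℕ.<? p) ×-dec (p ℕ.<? p′) ×-dec (p′ ℕ.<? N)) (0<p , p<p′ , p′<N)))
    (All.lookup (Max.xs≤max (gap 1 1) (concatMap column [ 1 ⋯ p ])) (∈-concatMap⁺ column
      (lose (∈-[⋯]⁺ (ℕ.≤-trans 1≤i i≤i′) i′≤p) (∈-map⁺ (λ i → gap i i′) (∈-[⋯]⁺ 1≤i i≤i′)))))
    where
    gap : ℕ → ℕ → Carrier
    gap i i′ = - (dKL i p + dKL i′ p′) + (dKL i p′ + dKL i′ p)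

    column : ℕ → List Carrier
    column i′ = map (λ i → gap i i′) [ 1 ⋯ i′ ]

  0≤δ-fuel : ∀ f p → 0# ≤ᴿ δ-fuel f p
  0≤δ-fuel zero    p = ≤ᴿ-refl
  0≤δ-fuel (suc f) p = if-both (0# ≤ᴿ_) (does ((0 ℕ.<? p) ×-dec (p ℕ.<? N)))
    (Max.⊥≤max 0# (δ-fuel f (p ∸ 2 ^ ν₂ p) + Δ (p ∸ 2 ^ ν₂ p) p ∷
                   δ-fuel f (p ℕ.+ 2 ^ ν₂ p) + Δ p (p ℕ.+ 2 ^ ν₂ p) ∷ []))
    ≤ᴿ-refl

  module _ {s l p : ℕ} (2^1+s∣l : 2 ^ suc s ∣ l) (p≡l+2^s : p ≡ l ℕ.+ 2 ^ s)
           (0<p : 0 < p) (p<N : p < N) where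
    private
      ν₂p≡s : ν₂ p ≡ s
      ν₂p≡s = ≡.trans (cong ν₂ p≡l+2^s) (ν₂-odd-multiple {s} 2^1+s∣l)

      below : ∀ f → ℕ → Carrier
      below f l = δ-fuel f l + Δ l p

      above : ∀ f → ℕ → Carrier
      above f r = δ-fuel f r + Δ p r

      candidates≤δ-fuel : ∀ f → All (_≤ᴿ δ-fuel (suc f) p)
        (below f (p ∸ 2 ^ ν₂ p) ∷ above f (p ℕ.+ 2 ^ ν₂ p) ∷ [])
      candidates≤δ-fuel f = subst (λ x → All (_≤ᴿ x) candidates)
        (≡.sym (if-dec-true ((0 ℕ.<? p) ×-dec (p ℕ.<? N)) (0<p , p<N)))
        (Max.xs≤max 0# candidates)
        where candidates = below f (p ∸ 2 ^ ν₂ p) ∷ above f (p ℕ.+ 2 ^ ν₂ p) ∷ []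

    -- As `ν₂ p` equals `s`, subtracting `2 ^ ν₂ p` lands exactly on `l`, and the left side is a
    -- candidate in the maximum.
    δ-fuel-below : ∀ f → δ-fuel f l + Δ l p ≤ᴿ δ-fuel (suc f) p
    δ-fuel-below f = subst (λ l → below f l ≤ᴿ δ-fuel (suc f) p) p∸2^ν₂p≡l
      (All.lookup (candidates≤δ-fuel f) (here refl))
      where
      p∸2^ν₂p≡l : p ∸ 2 ^ ν₂ p ≡ l
      p∸2^ν₂p≡l = ≡.trans (≡.cong₂ (λ p s → p ∸ 2 ^ s) p≡l+2^s ν₂p≡s) (ℕ.m+n∸n≡m l (2 ^ s))

    δ-fuel-above : ∀ f → δ-fuel f (p ℕ.+ 2 ^ s) + Δ p (p ℕ.+ 2 ^ s) ≤ᴿ δ-fuel (suc f) p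
    δ-fuel-above f = subst (λ s → above f (p ℕ.+ 2 ^ s) ≤ᴿ δ-fuel (suc f) p) ν₂p≡s
      (All.lookup (candidates≤δ-fuel f) (there (here refl)))

  -- Near-optimality of the columns selected in one matrix.

  module Column (prev : ℕ → ℝ₋∞) where
    A : ℕ → ℕ → ℝ₋∞
    A = matrix prev

    open MonotoneMaxima decTotalOrder₋ A
    open LeftmostArgmax decTotalOrder₋ A

    A-lower : ∀ {p i} → i ≤ p → A p i ≡ prev (i ∸ 1) +₋ dKL i p
    A-lower {p} {i} i≤p = if-dec-true (i ℕ.≤? p) i≤p

    A-upper : ∀ {p i} → p < i → A p i ≡ ⊥₋
    A-upper {p} {i} p<i = if-dec-false (i ℕ.≤? p) (ℕ.<⇒≱ p<i)

    module _ {p p′ i i′ : ℕ} (0<p : 0 < p) (p<p′ : p < p′) (p′<N : p′ < N)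
             (1≤i : 1 ≤ i) (i≤i′ : i ≤ i′) (i′≤p : i′ ≤ p) where
      private
        i≤p   = ℕ.≤-trans i≤i′ i′≤p
        i≤p′  = ℕ.≤-trans i≤p (ℕ.<⇒≤ p<p′)
        i′≤p′ = ℕ.≤-trans i′≤p (ℕ.<⇒≤ p<p′)

      -- Moves a comparison to a row of higher index, for columns left of the selected one. As
      -- `i′ ≤ p`, all four entries lie in the lower triangle, and their costs form a gap bounded by
      -- `Δ`.
      exchange-down : ∀ {e} → A p i ≤₋ A p i′ +₋ e → A p′ i ≤₋ A p′ i′ +₋ (e + Δ p p′)
      exchange-down {e} Api≤Api′+e
        rewrite A-lower i≤p | A-lower i′≤p | A-lower i≤p′ | A-lower i′≤p′ =
        exchange₋ (prev (i ∸ 1)) (prev (i′ ∸ 1)) Api≤Api′+e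
          (gap≤Δ 0<p p<p′ p′<N 1≤i i≤i′ i′≤p)

      -- The reverse passage, for columns right of the selected one.
      exchange-up : ∀ {e} → A p′ i′ ≤₋ A p′ i +₋ e → A p i′ ≤₋ A p i +₋ (e + Δ p p′)
      exchange-up {e} Ap′i′≤Ap′i+e
        rewrite A-lower i≤p | A-lower i′≤p | A-lower i≤p′ | A-lower i′≤p′ =
        exchange₋ (prev (i′ ∸ 1)) (prev (i ∸ 1)) Ap′i′≤Ap′i+e
          (gap-comm (dKL i p) (dKL i′ p′) (dKL i p′) (dKL i′ p)
            (gap≤Δ 0<p p<p′ p′<N 1≤i i≤i′ i′≤p))

    -- Here s is the exponent ν₂ p, so M ∸ s is the depth of row p in the recursion.
    -- Bounding by δ-fuel f p for every f ≥ M ∸ s, instead of by δ p, gives an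
    -- induction that never compares δ-fuel at two amounts of fuel.
    record NearOptimal (s p J : ℕ) : Set ℓ where
      field
        1≤J  : 1 ≤ J
        J≤p  : J ≤ p
        near : ∀ {j} → 1 ≤ j → j ≤ p → ∀ f → M ≤ f ℕ.+ s → A p j ≤₋ A p J +₋ δ-fuel f p
    open NearOptimal

    -- A smaller exponent demands more fuel. This hands the bounding rows on to the subblocks.
    weaken : ∀ {s s′ p J} → s′ ≤ s → NearOptimal s p J → NearOptimal s′ p J
    weaken s′≤s opt = record
      { 1≤J  = 1≤J opt
      ; J≤p  = J≤p opt
      ; near = λ 1≤j j≤p f M≤f+s′ → near opt 1≤j j≤p f (ℕ.≤-trans M≤f+s′ (ℕ.+-monoʳ-≤ f s′≤s))
      }

    -- Row 0 is a fictitious boundary for blocks with no processed row below them, where the column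
    -- range is still untrimmed on the left. `RightBound` treats row `N` likewise.
    LeftBound : ℕ → ℕ → ℕ → Set ℓ
    LeftBound s l L = (l ≡ 0 × L ≡ 1) ⊎ (0 < l × NearOptimal s l L)

    RightBound : ℕ → ℕ → ℕ → Set ℓ
    RightBound s r R = (r ≡ N × R ≡ N ∸ 1) ⊎ (r < N × NearOptimal s r R)

    LeftBound⇒1≤L : ∀ {s l L} → LeftBound s l L → 1 ≤ L
    LeftBound⇒1≤L (inj₁ (_ , refl)) = s≤s z≤n
    LeftBound⇒1≤L (inj₂ (_ , opt))  = 1≤J opt

    LeftBound⇒L≤1+l : ∀ {s l L} → LeftBound s l L → L ≤ suc l
    LeftBound⇒L≤1+l (inj₁ (refl , refl)) = s≤s z≤n
    LeftBound⇒L≤1+l (inj₂ (_ , opt))     = ℕ.m≤n⇒m≤1+n (J≤p opt)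

    middle-nearOptimal : ∀ {s l m r L R} → s < M → 2 ^ suc s ∣ l →
      m ≡ l ℕ.+ 2 ^ s → r ≡ m ℕ.+ 2 ^ s → r ≤ N → L ≤ R →
      LeftBound (suc s) l L → RightBound (suc s) r R →
      NearOptimal s m (leftmostArgmax (A m) L (R ∸ L))
    middle-nearOptimal {s} {l} {m} {r} {L} {R} s<M 2^1+s∣l m≡ refl r≤N L≤R left right = record
      { 1≤J  = ℕ.≤-trans (LeftBound⇒1≤L left) L≤J
      ; J≤p  = ℕ.≮⇒≥ λ m<J → ℕ.<⇒≱ m<J (J≤m m<J)
      ; near = near-middle
      }
      where
      J = leftmostArgmax (A m) L (R ∸ L)

      L≤J : L ≤ J
      L≤J = leftmostArgmax-≥ (A m) L (R ∸ L)

      l<m : l < m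
      l<m = subst (l <_) (≡.sym m≡) (ℕ.m<m+n l (ℕ.m^n>0 2 s))

      m<r : m < r
      m<r = ℕ.m<m+n m (ℕ.m^n>0 2 s)

      0<m : 0 < m
      0<m = ℕ.≤-<-trans z≤n l<m

      m<N : m < N
      m<N = ℕ.<-≤-trans m<r r≤N

      -- The entries right of column m are -∞, so if one of them is selected then
      -- all the entries are -∞ and the leftmost one, which is in column L, wins.
      J≤m : m < J → J ≤ m
      J≤m m<J = subst (_≤ m) (≡.sym J≡L) (ℕ.≤-trans (LeftBound⇒L≤1+l left) l<m)
        where
        J≡L : J ≡ L
        J≡L = leftmostArgmax-leftmost (A m) L (R ∸ L)
          (subst (_≤₋ A m L) (≡.sym (A-upper m<J)) (⊥₋≤ A m L))

      max-in-range : ∀ {j} → L ≤ j → j ≤ R → A m j ≤₋ A m J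
      max-in-range {j} L≤j j≤R = leftmostArgmax-max (A m) L (R ∸ L) L≤j
        (subst (j ≤_) (≡.sym (ℕ.m+[n∸m]≡n L≤R)) j≤R)

      near-below : ∀ {j} → 1 ≤ j → j < L → ∀ f → M ≤ f ℕ.+ suc s → LeftBound (suc s) l L →
                   A m j ≤₋ A m J +₋ δ-fuel (suc f) m
      near-below 1≤j j<L f M≤f+1+s (inj₁ (_ , refl))   = contradiction j<L (ℕ.≤⇒≯ 1≤j)
      near-below 1≤j j<L f M≤f+1+s (inj₂ (0<l , opt)) =
        ≤₋-trans (exchange-down 0<l l<m m<N 1≤j (ℕ.<⇒≤ j<L) (J≤p opt)
                   (near opt 1≤j (ℕ.≤-trans (ℕ.<⇒≤ j<L) (J≤p opt)) f M≤f+1+s))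
        -- Column `L` was searched in row `m`, so `J` is at least as good there.
        (≤₋-trans (+₋-monoˡ _ (max-in-range ℕ.≤-refl L≤R))
                  (+₋-monoʳ (A m J) (δ-fuel-below {s} 2^1+s∣l m≡ 0<m m<N f)))

      near-above : ∀ {j} → j ≤ m → R < j → ∀ f → M ≤ f ℕ.+ suc s → RightBound (suc s) r R →
                   A m j ≤₋ A m J +₋ δ-fuel (suc f) m
      -- The range still ends at `N ∸ 1`, and `m < N` leaves no column `j ≤ m` beyond it.
      near-above {j} j≤m R<j f M≤f+1+s (inj₁ (_ , refl)) =
        contradiction (ℕ.<-≤-trans R<j j≤m) (ℕ.≤⇒≯ (ℕ.m+n≤o⇒m≤o∸n m (subst (_≤ N) (ℕ.+-comm 1 m) m<N)))
      near-above {j} j≤m R<j f M≤f+1+s (inj₂ (r<N , opt)) =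
        ≤₋-trans (exchange-up 0<m m<r r<N (1≤J opt) (ℕ.<⇒≤ R<j) j≤m
                   (near opt (ℕ.≤-trans (1≤J opt) (ℕ.<⇒≤ R<j)) (ℕ.≤-trans j≤m (ℕ.<⇒≤ m<r)) f M≤f+1+s))
        (≤₋-trans (+₋-monoˡ _ (max-in-range L≤R ℕ.≤-refl))
                  (+₋-monoʳ (A m J) (δ-fuel-above {s} 2^1+s∣l m≡ 0<m m<N f)))

      near-middle : ∀ {j} → 1 ≤ j → j ≤ m → ∀ f → M ≤ f ℕ.+ s → A m j ≤₋ A m J +₋ δ-fuel f m
      near-middle 1≤j j≤m zero M≤s = contradiction s<M (ℕ.≤⇒≯ M≤s)
      near-middle {j} 1≤j j≤m (suc f) M≤1+f+s = by-position (j ℕ.<? L) (R ℕ.<? j)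
        where
        -- The bounding rows carry exponent `suc s`, which makes up for the unit of fuel spent in
        -- passing to them.
        M≤f+1+s = subst (M ≤_) (≡.sym (ℕ.+-suc f s)) M≤1+f+s

        by-position : Dec (j < L) → Dec (R < j) → A m j ≤₋ A m J +₋ δ-fuel (suc f) m
        by-position (yes j<L) _         = near-below 1≤j j<L f M≤f+1+s left
        by-position (no _)    (yes R<j) = near-above j≤m R<j f M≤f+1+s right
        by-position (no j≮L)  (no R≮j)  =
          ≤₋-trans (max-in-range (ℕ.≮⇒≥ j≮L) (ℕ.≮⇒≥ R≮j))
                   (≤₋-+₋-nonneg (A m J) (0≤δ-fuel (suc f) m))

    -- The block of rows strictly between l and l + 2 ^ s, with l = 0 or l + 2 ^ s = N
    -- when there is no processed row on that side.
    search-nearOptimal : ∀ s {fuel l b L R} → s ≤ M → 2 ^ s ≤ suc fuel →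
      2 ^ s ∣ l → suc b ≡ l ℕ.+ 2 ^ s → suc b ≤ N → L ≤ R →
      LeftBound s l L → RightBound s (suc b) R →
      ∀ {p} → l < p → p ≤ b → NearOptimal 0 p (search fuel (suc l) b L R p)
    search-nearOptimal zero {l = l} _ _ _ 1+b≡l+1 _ _ _ _ {p} l<p p≤b =
      contradiction p≤b (ℕ.<⇒≱ (subst (_≤ p) (≡.sym (≡.trans 1+b≡l+1 (ℕ.+-comm l 1))) l<p))
    -- A block of positive exponent contains a row, so the fuel cannot have run out.
    search-nearOptimal (suc s) {zero} _ 2^1+s≤1 _ _ _ _ _ _ _ _ =
      contradiction 2^1+s≤1 (ℕ.<⇒≱ (ℕ.^-monoʳ-< 2 (s≤s (s≤s z≤n)) {0} {suc s} (s≤s z≤n)))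
    search-nearOptimal (suc s) {suc fuel} {l} {b} {L} {R} s<M 2^1+s≤2+fuel 2^1+s∣l 1+b≡ 1+b≤N L≤R
                       left right {p} l<p p≤b = go (ℕ.<-cmp p m)
      where
      a≤b : suc l ≤ b
      a≤b = ℕ.≤-trans l<p p≤b

      m = (suc l ℕ.+ b) / 2
      J = leftmostArgmax (A m) L (R ∸ L)

      1+b≡l+2^s+2^s : suc b ≡ l ℕ.+ 2 ^ s ℕ.+ 2 ^ s
      1+b≡l+2^s+2^s = ≡.trans 1+b≡
        (≡.trans (cong (l ℕ.+_) (2^[1+n]≡2^n+2^n s)) (≡.sym (ℕ.+-assoc l (2 ^ s) (2 ^ s))))

      -- The rows run from `l + 1` to `l + 2 ^ suc s - 1`, so their ends add up to twice `l + 2 ^ s`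
      -- and the halving is exact.
      m≡ : m ≡ l ℕ.+ 2 ^ s
      m≡ = ≡.trans (cong (_/ 2) 1+l+b≡[l+2^s]*2) (m*n/n≡m (l ℕ.+ 2 ^ s) 2)
        where
        1+l+b≡[l+2^s]*2 : suc l ℕ.+ b ≡ (l ℕ.+ 2 ^ s) ℕ.* 2
        1+l+b≡[l+2^s]*2 = ≡.trans (≡.sym (ℕ.+-suc l b))
          (≡.trans (cong (l ℕ.+_) 1+b≡l+2^s+2^s) (rearrange l (2 ^ s)))
          where
          rearrange : ∀ l x → l ℕ.+ (l ℕ.+ x ℕ.+ x) ≡ (l ℕ.+ x) ℕ.* 2
          rearrange = solve-∀

      1+b≡m+2^s : suc b ≡ m ℕ.+ 2 ^ s
      1+b≡m+2^s = ≡.trans 1+b≡l+2^s+2^s (cong (ℕ._+ 2 ^ s) (≡.sym m≡))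

      1+[m∸1]≡m : suc (m ∸ 1) ≡ m
      1+[m∸1]≡m = ℕ.m+[n∸m]≡n (subst (1 ≤_) (≡.sym m≡) (ℕ.≤-trans (ℕ.m^n>0 2 s) (ℕ.m≤n+m (2 ^ s) l)))

      m<1+b : m < suc b
      m<1+b = subst (m <_) (≡.sym 1+b≡m+2^s) (ℕ.m<m+n m (ℕ.m^n>0 2 s))

      m<N : m < N
      m<N = ℕ.<-≤-trans m<1+b 1+b≤N

      0<m : 0 < m
      0<m = subst (0 <_) 1+[m∸1]≡m (s≤s z≤n)

      2^s∣l : 2 ^ s ∣ l
      2^s∣l = ∣-trans (n∣m*n 2) 2^1+s∣l

      -- Since `1 ≤ 2 ^ s`, halving `2 ^ suc s` lowers it by at least the one unit of fuel spent.
      2^s≤1+fuel : 2 ^ s ≤ suc fuel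
      2^s≤1+fuel = ℕ.≤-pred (ℕ.≤-trans (ℕ.+-monoˡ-≤ (2 ^ s) (ℕ.m^n>0 2 s))
        (subst (_≤ suc (suc fuel)) (2^[1+n]≡2^n+2^n s) 2^1+s≤2+fuel))

      L≤J : L ≤ J
      L≤J = leftmostArgmax-≥ (A m) L (R ∸ L)

      J≤R : J ≤ R
      J≤R = subst (J ≤_) (ℕ.m+[n∸m]≡n L≤R) (leftmostArgmax-≤ (A m) L (R ∸ L))

      opt-m : NearOptimal s m J
      opt-m = middle-nearOptimal {s} s<M 2^1+s∣l m≡ 1+b≡m+2^s 1+b≤N L≤R left right

      go : _ → NearOptimal 0 p (search (suc fuel) (suc l) b L R p)
      go (tri< p<m _ _) = subst (NearOptimal 0 p) (≡.sym (search-< a≤b p<m))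
        (search-nearOptimal s (ℕ.<⇒≤ s<M) 2^s≤1+fuel 2^s∣l
          -- The truncated `m ∸ 1` is a true predecessor because `m > 0`, so `m` bounds this
          -- subblock.
          (≡.trans 1+[m∸1]≡m m≡) (subst (_≤ N) (≡.sym 1+[m∸1]≡m) (ℕ.<⇒≤ m<N)) L≤J
          (Sum.map₂ (λ (0<l , opt) → 0<l , weaken (ℕ.n≤1+n s) opt) left)
          (inj₂ (subst (λ r → r < N × NearOptimal s r J) (≡.sym 1+[m∸1]≡m) (m<N , opt-m)))
          l<p (ℕ.≤-pred (subst (p <_) (≡.sym 1+[m∸1]≡m) p<m)))
      -- Exponent 0 is the weakest claim and fits rows at every depth.
      go (tri≈ _ p≡m _) = subst (NearOptimal 0 p) (≡.sym (search-≡ a≤b p≡m))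
        (subst (λ p → NearOptimal 0 p J) (≡.sym p≡m) (weaken z≤n opt-m))
      go (tri> _ _ m<p) = subst (NearOptimal 0 p) (≡.sym (search-> a≤b m<p))
        (search-nearOptimal s (ℕ.<⇒≤ s<M) 2^s≤1+fuel
          (subst (2 ^ s ∣_) (≡.sym m≡) (∣m∣n⇒∣m+n 2^s∣l ∣-refl))
          1+b≡m+2^s 1+b≤N J≤R
          (inj₂ (0<m , opt-m))
          (Sum.map₂ (λ (r<N , opt) → r<N , weaken (ℕ.n≤1+n s) opt) right)
          m<p p≤b)

    -- The whole run is the block of exponent `M` between the fictitious rows 0 and `N`. From
    -- `M ≥ 1` its initial column range is nonempty.
    Ĵ-nearOptimal : 1 ≤ M → ∀ {p} → 1 ≤ p → p ≤ N ∸ 1 → NearOptimal 0 p (Ĵ (N ∸ 1) p)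
    Ĵ-nearOptimal 1≤M = search-nearOptimal M ℕ.≤-refl (ℕ.≤-reflexive (≡.sym 1+[N∸1]≡N)) ((2 ^ M) ∣0)
      1+[N∸1]≡N (ℕ.≤-reflexive 1+[N∸1]≡N) 1≤N∸1 (inj₁ (refl , refl)) (inj₁ (1+[N∸1]≡N , refl))
      where
      1+[N∸1]≡N : suc (N ∸ 1) ≡ N
      1+[N∸1]≡N = ℕ.m+[n∸m]≡n (ℕ.m^n>0 2 M)

      1≤N∸1 : 1 ≤ N ∸ 1
      1≤N∸1 = ℕ.m+n≤o⇒m≤o∸n 1 (ℕ.^-monoʳ-≤ 2 1≤M)

  -- Accumulation of the error over the columns of the table.

  δ≤δmax : ∀ {p} → 1 ≤ p → p ≤ N ∸ 1 → δ p ≤ᴿ δmax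
  δ≤δmax 1≤p p≤N∸1 = All.lookup (Max.xs≤max (δ 1) (map δ [ 1 ⋯ N ∸ 1 ]))
    (∈-map⁺ δ (∈-[⋯]⁺ 1≤p p≤N∸1))

  module _ (1≤M : 1 ≤ M) where
    open Column

    transitions : ℕ → ℕ → List ℝ₋∞
    transitions p q = map (λ i → DPtrue (i ∸ 1) q +₋ dKL i (suc p)) [ 1 ⋯ suc p ]

    -- The selected column is at least 1 and at most the row index, so the algorithm follows a
    -- transition that the exact recursion also considers. Induction on `q` compares the earlier
    -- entries.
    DPmm≤DPtrue : ∀ p q → p ≤ N ∸ 1 → DPmm p q ≤₋ DPtrue p q
    DPmm≤DPtrue zero    zero    _ = ≤₋-refl
    DPmm≤DPtrue zero    (suc q) _ = ≤₋-refl
    DPmm≤DPtrue (suc p) zero    _ = ≤₋-refl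
    DPmm≤DPtrue (suc p) (suc q) p<N∸1 =
      subst (_≤₋ DPtrue (suc p) (suc q)) (≡.sym (A-lower prev J≤1+p))
        (≤₋-trans (+₋-monoˡ _ (DPmm≤DPtrue (J ∸ 1) q J∸1≤N∸1))
          (All.lookup (Max₋.xs≤max ⊥₋ (transitions p q))
            (∈-map⁺ (λ i → DPtrue (i ∸ 1) q +₋ dKL i (suc p)) (∈-[⋯]⁺ 1≤J J≤1+p))))
      where
      prev = λ i → DPmm i q
      J = MonotoneMaxima.Ĵ decTotalOrder₋ (A prev) (N ∸ 1) (suc p)
      open NearOptimal (Ĵ-nearOptimal prev 1≤M (s≤s z≤n) p<N∸1) renaming (J≤p to J≤1+p)
      J∸1≤N∸1 : J ∸ 1 ≤ N ∸ 1
      J∸1≤N∸1 = ℕ.≤-trans (ℕ.m∸n≤m J 1) (ℕ.≤-trans J≤1+p p<N∸1)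

    -- The exact maximum is bounded transition by transition: induction on `q` accounts for the
    -- error of the earlier entry, and near-optimality of `J` adds one more `δmax`.
    DPtrue≤DPmm+qδmax : ∀ p q → p ≤ N ∸ 1 → DPtrue p q ≤₋ DPmm p q +₋ q · δmax
    DPtrue≤DPmm+qδmax zero    zero    _ = ≤₋-+₋-nonneg [ 0# ] ≤ᴿ-refl
    DPtrue≤DPmm+qδmax zero    (suc q) _ = ⊥₋≤ _
    DPtrue≤DPmm+qδmax (suc p) zero    _ = ⊥₋≤ _
    DPtrue≤DPmm+qδmax (suc p) (suc q) p<N∸1 =
      Max₋.max≤v⁺ (⊥₋≤ _) (All.map⁺ (All.tabulate λ i∈ →
        let 1≤i , i≤1+p = ∈-[1⋯]⁻ i∈ in transition-≤ 1≤i i≤1+p))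
      where
      prev = λ i → DPmm i q
      J = MonotoneMaxima.Ĵ decTotalOrder₋ (A prev) (N ∸ 1) (suc p)
      open NearOptimal (Ĵ-nearOptimal prev 1≤M (s≤s z≤n) p<N∸1)

      -- `δ` runs on fuel `N`, which exceeds the `M` demanded at exponent 0.
      M≤N+0 : M ≤ N ℕ.+ 0
      M≤N+0 = ℕ.≤-trans (ℕ.<⇒≤ (n<2^n M)) (ℕ.m≤m+n N 0)

      transition-≤ : ∀ {i} → 1 ≤ i → i ≤ suc p →
        DPtrue (i ∸ 1) q +₋ dKL i (suc p) ≤₋ DPmm (suc p) (suc q) +₋ suc q · δmax
      transition-≤ {i} 1≤i i≤1+p =
        ≤₋-trans (+₋-monoˡ _ (DPtrue≤DPmm+qδmax (i ∸ 1) q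
          (ℕ.≤-trans (ℕ.m∸n≤m i 1) (ℕ.≤-trans i≤1+p p<N∸1))))
        -- Moving the inherited error to the end makes the matrix entry in column `i` reappear.
        (≤₋-trans (+₋-swap-≤ (prev (i ∸ 1)) (q · δmax) (dKL i (suc p)))
        (≤₋-trans (+₋-monoˡ (q · δmax)
          (subst (_≤₋ A prev (suc p) J +₋ δ (suc p)) (A-lower prev i≤1+p) (near 1≤i i≤1+p N M≤N+0)))
        (≤₋-trans (+₋-monoˡ (q · δmax)
          (+₋-monoʳ (A prev (suc p) J) (δ≤δmax (s≤s z≤n) p<N∸1)))
        -- `suc q · δmax` unfolds to `δmax + q · δmax`.
        (+₋-assoc-≤ (A prev (suc p) J) δmax (q · δmax)))))

theorem9 :
    ∀ {ℓ} (ℝ : Reals ℓ) (M k : ℕ) (g h : ℕ → Reals.Carrier ℝ) →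
    let open Reals ℝ hiding (_^_)
        N = 2 ^ M
        open Tables ℝ N g h
    in
    1 ≤ M → 2 ≤ k → k < N →
    (∀ i → 1 ≤ i → i ≤ N → 0# ≤ᴿ g i) →
    (∀ i → 1 ≤ i → i ≤ N → 0# <ᴿ h i) →
    ∑ g 1 N ≈ 1# → ∑ h 1 N ≈ 1# →
    ∀ p q → 1 ≤ p → p ≤ N ∸ 1 → 1 ≤ q → q ≤ k ∸ 1 →
    (DPmm p q ≤₋ DPtrue p q) × (DPtrue p q ≤₋ (DPmm p q +₋ q · δmax))
theorem9 ℝ M k g h 1≤M _ _ _ _ _ _ p q _ p≤N∸1 _ _ =
  DPmm≤DPtrue 1≤M p q p≤N∸1 , DPtrue≤DPmm+qδmax 1≤M p q p≤N∸1
  where open Accuracy ℝ M g h
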